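{- For each $s\in\{1,5,9,13\}$, there is a binary singly even self-dual $[82,41,14]$ code whose shadow has minimum weight $s$.
   Context: All codes are binary: a code of length $n$ is a subspace of $\mathbb{F}_2^n$, and $[n,k,d]$ denotes length $n$, dimension $k$, minimum weight $d$. A code $C$ is self-dual if $C=C^\perp$ with respect to the standard inner product. A self-dual code is singly even if it contains a codeword of weight $\equiv 2 \pmod 4$. For a singly even self-dual code $C$, let $C_0$ be the subcode of codewords of weight $\equiv 0 \pmod 4$; the shadow of $C$ is $S=C_0^\perp\setminus C$, and its minimum weight is the smallest weight of a vector in $S$. -}

module Defs where

open import Data.Bool.Base using (Bool; true; false; _∧_; _xor_)
open import Data.Bool.Properties using (_≟_)
open import Data.Nat.Base using (ℕ; _≤_; _%_)
open import Data.Product.Base using (_×_; ∃)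
open import Data.Vec.Base using (Vec; count; foldr′; map; replicate; zipWith)
open import Data.Vec.Relation.Unary.All using (All)
open import Level using (0ℓ; suc)
open import Relation.Binary.PropositionalEquality.Core using (_≡_; _≢_)
open import Relation.Unary using (Pred; _∈_; _≐_; _∩_; _∖_)

-- The field with two elements: _xor_ is its addition, _∧_ its multiplication.
F₂ : Set
F₂ = Bool

Word : ℕ → Set
Word = Vec F₂

private
  variable
    n k : ℕ

infixl 6 _⊕_
infixr 7 _⊙_
infix  7 _·_

𝟎 : Word n
𝟎 = replicate _ false

_⊕_ : Word n → Word n → Word n
_⊕_ = zipWith _xor_

_⊙_ : F₂ → Word n → Word n
a ⊙ x = map (a ∧_) x

_·_ : Word n → Word n → F₂
x · y = foldr′ _xor_ false (zipWith _∧_ x y)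

weight : Word n → ℕ
weight = count (_≟ true)

record Code (n : ℕ) : Set (suc 0ℓ) where
  field
    Codeword : Pred (Word n) 0ℓ
    𝟎-mem    : 𝟎 ∈ Codeword
    ⊕-closed : ∀ {x y} → x ∈ Codeword → y ∈ Codeword → x ⊕ y ∈ Codeword
    ⊙-closed : ∀ a {x} → x ∈ Codeword → a ⊙ x ∈ Codeword

open Code public using (Codeword)

linearCombination : Vec F₂ k → Vec (Word n) k → Word n
linearCombination a b = foldr′ _⊕_ 𝟎 (zipWith _⊙_ a b)

record IsBasis (C : Code n) (b : Vec (Word n) k) : Set where
  field
    members     : All (Codeword C) b
    independent : ∀ a → linearCombination a b ≡ 𝟎 → a ≡ 𝟎
    spanning    : ∀ x → x ∈ Codeword C → ∃ λ a → linearCombination a b ≡ x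

HasDimension : Code n → ℕ → Set
HasDimension {n} C k = ∃ λ (b : Vec (Word n) k) → IsBasis C b

-- Every vector of P counts, the zero word included; it has to be excluded
-- explicitly when P is a code.
SmallestWeight : Pred (Word n) 0ℓ → ℕ → Set
SmallestWeight P d =
  (∃ λ x → x ∈ P × weight x ≡ d) × (∀ x → x ∈ P → d ≤ weight x)

HasMinimumWeight : Code n → ℕ → Set
HasMinimumWeight C d = SmallestWeight (Codeword C ∩ (_≢ 𝟎)) d

record IsCode[_,_,_] (n k d : ℕ) (C : Code n) : Set where
  field
    dimension     : HasDimension C k
    minimumWeight : HasMinimumWeight C d

infix 8 _^⊥

_^⊥ : Pred (Word n) 0ℓ → Pred (Word n) 0ℓ
(P ^⊥) x = ∀ y → y ∈ P → x · y ≡ false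

SelfDual : Code n → Set
SelfDual C = Codeword C ≐ Codeword C ^⊥

SinglyEven : Code n → Set
SinglyEven C = ∃ λ x → x ∈ Codeword C × weight x % 4 ≡ 2

-- When C is self-dual its codewords have even weight and this is a subcode;
-- otherwise it is just a set of words.
doublyEvenSubcode : Code n → Pred (Word n) 0ℓ
doublyEvenSubcode C x = x ∈ Codeword C × weight x % 4 ≡ 0

shadow : Code n → Pred (Word n) 0ℓ
shadow C = doublyEvenSubcode C ^⊥ ∖ Codeword C

-- Each code is the row space of [I | A] with A orthogonal, so it is self-dual
-- with even weights, and the right half b = aA of a codeword determines the
-- left one as a = bAᵀ. A nonzero codeword of weight at most 12 would have at
-- most 6 ones on the left or at most 5 on the right, so it would appear among
-- the sums of few rows of A or of Aᵀ. Sums of at least four rows are found by a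
-- meet in the middle: cut the 41 columns into four blocks of ten and a rest;
-- a sum of weight w has weight at most w / 4 on some block, so there the sum of
-- its first three rows nearly agrees with the sum of the others.
--
-- A word y with y · c ≡ wt c / 2 (mod 2) for all codewords c lies in the
-- shadow, the shadow is the coset y + C, and its weights are congruent modulo 4.
-- Thus a shadow vector lighter than wt y has weight at most wt y - 4, and the
-- coset has so few candidates that they can be enumerated.

module Submission where

open import Algebra.Bundles using (CommutativeSemigroup)
import Algebra.Properties.CommutativeSemigroup as CommutativeSemigroupProperties
open import Data.Bool.Base using (Bool; true; false; _∧_; _xor_; if_then_else_)
open import Data.Bool.Properties
  using (_≟_; xor-assoc; xor-comm; xor-identityˡ; xor-identityʳ; xor-same;
         ∧-comm; ∧-conicalˡ; ∧-conicalʳ; ∧-distribʳ-xor; ∧-idem; ∧-identityʳ)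
open import Data.Empty using (⊥)
open import Data.List.Base using (List; []; _∷_)
open import Data.List.Membership.Propositional using (_∈_)
open import Data.List.Relation.Unary.Any using (here; there)
open import Data.Nat.Base
open import Data.Nat.Divisibility
open import Data.Nat.DivMod
open import Data.Nat.Properties hiding (_≟_)
open import Data.Nat.Solver using (module +-*-Solver)
open import Data.Product.Base using (_×_; _,_; ∃; proj₁; proj₂)
open import Data.Vec.Base
  using (Vec; []; _∷_; _++_; _⊛_; drop; foldr′; map; replicate; take; transpose; zipWith)
open import Data.Vec.Properties
  using (≡-dec; ++-injectiveˡ; ++-injectiveʳ; drop-zipWith; map-++; map-const; map-id;
         map-replicate; take++drop≡id; take-zipWith; zipWith-++; zipWith-assoc; zipWith-comm;
         zipWith-identityˡ; zipWith-identityʳ; zipWith-is-⊛)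
open import Data.Vec.Relation.Unary.All as All using (All; []; _∷_)
open import Level using (0ℓ)
open import Relation.Binary.PropositionalEquality
open import Relation.Nullary using (Dec; Reflects; contradiction; does; invert; no; proof; yes; ¬_)
open import Relation.Unary using (Pred)

open import Defs
open +-*-Solver using (solve; con; _:+_; _:*_; _:=_)

private
  variable
    d k m n : ℕ

-- Linear algebra over F₂

infixl 7 _⋆_

_⋆_ : Word k → Vec (Word n) k → Word n
a ⋆ A = linearCombination a A

-- The product A vᵀ, as against aA for `a ⋆ A`. With `v` as the first factor its entries unfold to
-- those of `⊙`, which `transpose-▷` relies on.
_▷_ : Vec (Word n) k → Word n → Word k
A ▷ v = map (v ·_) A

⊕-assoc : (x y z : Word n) → (x ⊕ y) ⊕ z ≡ x ⊕ (y ⊕ z)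
⊕-assoc = zipWith-assoc xor-assoc

⊕-comm : (x y : Word n) → x ⊕ y ≡ y ⊕ x
⊕-comm = zipWith-comm xor-comm

⊕-identityˡ : (x : Word n) → 𝟎 ⊕ x ≡ x
⊕-identityˡ = zipWith-identityˡ xor-identityˡ

⊕-identityʳ : (x : Word n) → x ⊕ 𝟎 ≡ x
⊕-identityʳ = zipWith-identityʳ xor-identityʳ

⊕-same : (x : Word n) → x ⊕ x ≡ 𝟎
⊕-same []      = refl
⊕-same (b ∷ x) = cong₂ _∷_ (xor-same b) (⊕-same x)

⊕-commutativeSemigroup : ℕ → CommutativeSemigroup _ _
⊕-commutativeSemigroup n = record
  { Carrier = Word n
  ; isCommutativeSemigroup = record
    { isSemigroup = record
      { isMagma = record { isEquivalence = isEquivalence ; ∙-cong = cong₂ _⊕_ }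
      ; assoc   = ⊕-assoc
      }
    ; comm = ⊕-comm
    }
  }

module ⊕ {n} = CommutativeSemigroupProperties (⊕-commutativeSemigroup n)

⊕-cancel : (x y : Word n) → x ⊕ (x ⊕ y) ≡ y
⊕-cancel x y = begin
  x ⊕ (x ⊕ y)  ≡⟨ ⊕-assoc x x y ⟨
  (x ⊕ x) ⊕ y  ≡⟨ cong (_⊕ y) (⊕-same x) ⟩
  𝟎 ⊕ y        ≡⟨ ⊕-identityˡ y ⟩
  y            ∎
  where open ≡-Reasoning

true-⊙ : (x : Word n) → true ⊙ x ≡ x
true-⊙ = map-id

false-⊙ : (x : Word n) → false ⊙ x ≡ 𝟎
false-⊙ x = map-const x false

𝟎-++ : ∀ m → 𝟎 {m} ++ 𝟎 {n} ≡ 𝟎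
𝟎-++ zero    = refl
𝟎-++ (suc m) = cong (false ∷_) (𝟎-++ m)

-- Over F₂ the only scalars are 0 and 1, so additive maps are linear and commute with `⋆`.
record Additive (f : Word m → Word n) : Set where
  field
    homo-𝟎 : f 𝟎 ≡ 𝟎
    homo-⊕ : ∀ x y → f (x ⊕ y) ≡ f x ⊕ f y

open Additive

⋆-false : (a : Word k) (r : Word n) (A : Vec (Word n) k) → (false ∷ a) ⋆ (r ∷ A) ≡ a ⋆ A
⋆-false a r A = trans (cong (_⊕ a ⋆ A) (false-⊙ r)) (⊕-identityˡ (a ⋆ A))

⋆-true : (a : Word k) (r : Word n) (A : Vec (Word n) k) → (true ∷ a) ⋆ (r ∷ A) ≡ r ⊕ a ⋆ A
⋆-true a r A = cong (_⊕ a ⋆ A) (true-⊙ r)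

⋆-additive : (A : Vec (Word n) k) → Additive (_⋆ A)
⋆-additive [] = record { homo-𝟎 = refl ; homo-⊕ = λ { [] [] → sym (⊕-identityˡ 𝟎) } }
⋆-additive (r ∷ A) = record
  { homo-𝟎 = trans (⋆-false 𝟎 r A) (homo-𝟎 (⋆-additive A))
  ; homo-⊕ = λ { (a ∷ x) (b ∷ y) → step a b x y }
  }
  where
  open ≡-Reasoning
  ⊙-xor : ∀ a b → (a xor b) ⊙ r ≡ a ⊙ r ⊕ b ⊙ r
  ⊙-xor false b     = sym (trans (cong (_⊕ b ⊙ r) (false-⊙ r)) (⊕-identityˡ (b ⊙ r)))
  ⊙-xor true  false = sym (trans (cong (true ⊙ r ⊕_) (false-⊙ r)) (⊕-identityʳ (true ⊙ r)))
  ⊙-xor true  true  = trans (false-⊙ r) (sym (⊕-same (true ⊙ r)))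
  step : ∀ a b x y → (a xor b) ⊙ r ⊕ (x ⊕ y) ⋆ A ≡ (a ⊙ r ⊕ x ⋆ A) ⊕ (b ⊙ r ⊕ y ⋆ A)
  step a b x y = begin
    (a xor b) ⊙ r ⊕ (x ⊕ y) ⋆ A              ≡⟨ cong₂ _⊕_ (⊙-xor a b) (homo-⊕ (⋆-additive A) x y) ⟩
    (a ⊙ r ⊕ b ⊙ r) ⊕ (x ⋆ A ⊕ y ⋆ A)        ≡⟨ ⊕.interchange (a ⊙ r) (b ⊙ r) (x ⋆ A) (y ⋆ A) ⟩
    (a ⊙ r ⊕ x ⋆ A) ⊕ (b ⊙ r ⊕ y ⋆ A)        ∎

additive-⋆ : {f : Word m → Word n} → Additive f →
             (a : Word k) (A : Vec (Word m) k) → f (a ⋆ A) ≡ a ⋆ map f A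
additive-⋆         f⁺ []          []      = homo-𝟎 f⁺
additive-⋆ {f = f} f⁺ (false ∷ a) (r ∷ A) = begin
  f ((false ∷ a) ⋆ (r ∷ A))          ≡⟨ cong f (⋆-false a r A) ⟩
  f (a ⋆ A)                          ≡⟨ additive-⋆ f⁺ a A ⟩
  a ⋆ map f A                        ≡⟨ ⋆-false a (f r) (map f A) ⟨
  (false ∷ a) ⋆ (f r ∷ map f A)      ∎
  where open ≡-Reasoning
additive-⋆ {f = f} f⁺ (true ∷ a)  (r ∷ A) = begin
  f ((true ∷ a) ⋆ (r ∷ A))           ≡⟨ cong f (⋆-true a r A) ⟩
  f (r ⊕ a ⋆ A)                      ≡⟨ homo-⊕ f⁺ r (a ⋆ A) ⟩
  f r ⊕ f (a ⋆ A)                    ≡⟨ cong (f r ⊕_) (additive-⋆ f⁺ a A) ⟩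
  f r ⊕ a ⋆ map f A                  ≡⟨ ⋆-true a (f r) (map f A) ⟨
  (true ∷ a) ⋆ (f r ∷ map f A)       ∎
  where open ≡-Reasoning

take-additive : ∀ m → Additive {m + n} (take m)
take-additive m = record { homo-𝟎 = take-𝟎 m ; homo-⊕ = take-zipWith _xor_ }
  where
  take-𝟎 : ∀ m → take m (𝟎 {m + n}) ≡ 𝟎
  take-𝟎 zero    = refl
  take-𝟎 (suc m) = cong (false ∷_) (take-𝟎 m)

drop-additive : ∀ m → Additive {m + n} (drop m)
drop-additive m = record { homo-𝟎 = drop-𝟎 m ; homo-⊕ = drop-zipWith _xor_ }
  where
  drop-𝟎 : ∀ m → drop m (𝟎 {m + n}) ≡ 𝟎
  drop-𝟎 zero    = refl
  drop-𝟎 (suc m) = drop-𝟎 m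

∘-additive : {f : Word m → Word n} {g : Word k → Word m} →
             Additive f → Additive g → Additive (λ x → f (g x))
∘-additive {f = f} {g} f⁺ g⁺ = record
  { homo-𝟎 = trans (cong f (homo-𝟎 g⁺)) (homo-𝟎 f⁺)
  ; homo-⊕ = λ x y → trans (cong f (homo-⊕ g⁺ x y)) (homo-⊕ f⁺ (g x) (g y))
  }

++-additive : {f : Word k → Word m} {g : Word k → Word n} →
              Additive f → Additive g → Additive (λ x → f x ++ g x)
++-additive {m = m} {f = f} {g} f⁺ g⁺ = record
  { homo-𝟎 = trans (cong₂ _++_ (homo-𝟎 f⁺) (homo-𝟎 g⁺)) (𝟎-++ m)
  ; homo-⊕ = λ x y → trans (cong₂ _++_ (homo-⊕ f⁺ x y) (homo-⊕ g⁺ x y))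
                           (sym (zipWith-++ _xor_ (f x) (g x) (f y) (g y)))
  }

id-additive : Additive {n} (λ x → x)
id-additive = record { homo-𝟎 = refl ; homo-⊕ = λ _ _ → refl }

·-comm : (x y : Word n) → x · y ≡ y · x
·-comm []      []      = refl
·-comm (a ∷ x) (b ∷ y) = cong₂ _xor_ (∧-comm a b) (·-comm x y)

𝟎-· : (y : Word n) → 𝟎 · y ≡ false
𝟎-· []      = refl
𝟎-· (b ∷ y) = 𝟎-· y

xor-commutativeSemigroup : CommutativeSemigroup _ _
xor-commutativeSemigroup = record
  { isCommutativeSemigroup = record
    { isSemigroup = record
      { isMagma = record { isEquivalence = isEquivalence ; ∙-cong = cong₂ _xor_ }
      ; assoc   = xor-assoc
      }
    ; comm = xor-comm
    }
  }

module xor = CommutativeSemigroupProperties xor-commutativeSemigroup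

·-distribʳ-⊕ : (z x y : Word n) → (x ⊕ y) · z ≡ (x · z) xor (y · z)
·-distribʳ-⊕ []      []      []      = refl
·-distribʳ-⊕ (c ∷ z) (a ∷ x) (b ∷ y) = begin
  ((a xor b) ∧ c) xor ((x ⊕ y) · z)                ≡⟨ cong₂ _xor_ (∧-distribʳ-xor c a b) (·-distribʳ-⊕ z x y) ⟩
  ((a ∧ c) xor (b ∧ c)) xor ((x · z) xor (y · z))  ≡⟨ xor.interchange (a ∧ c) (b ∧ c) (x · z) (y · z) ⟩
  ((a ∧ c) xor (x · z)) xor ((b ∧ c) xor (y · z))  ∎
  where
  open ≡-Reasoning

·-distribˡ-⊕ : (x y z : Word n) → x · (y ⊕ z) ≡ (x · y) xor (x · z)
·-distribˡ-⊕ x y z = begin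
  x · (y ⊕ z)          ≡⟨ ·-comm x (y ⊕ z) ⟩
  (y ⊕ z) · x          ≡⟨ ·-distribʳ-⊕ x y z ⟩
  (y · x) xor (z · x)  ≡⟨ cong₂ _xor_ (·-comm y x) (·-comm z x) ⟩
  (x · y) xor (x · z)  ∎
  where open ≡-Reasoning

·-++ : (x x′ : Word m) (y y′ : Word n) → (x ++ y) · (x′ ++ y′) ≡ (x · x′) xor (y · y′)
·-++ []      []        y y′ = refl
·-++ (a ∷ x) (a′ ∷ x′) y y′ =
  trans (cong ((a ∧ a′) xor_) (·-++ x x′ y y′)) (sym (xor-assoc (a ∧ a′) (x · x′) (y · y′)))

-- The unit vector `true ∷ 𝟎` detects the first entry, words beginning with `false` the others.
·-nondegenerate : (x y : Word n) → (∀ a → a · x ≡ a · y) → x ≡ y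
·-nondegenerate []      []      eq = refl
·-nondegenerate (b ∷ x) (c ∷ y) eq =
  cong₂ _∷_ head (·-nondegenerate x y λ a → eq (false ∷ a))
  where
  head : b ≡ c
  head = begin
    b                  ≡⟨ xor-identityʳ b ⟨
    b xor false        ≡⟨ cong (b xor_) (𝟎-· x) ⟨
    b xor (𝟎 · x)      ≡⟨ eq (true ∷ 𝟎) ⟩
    c xor (𝟎 · y)      ≡⟨ cong (c xor_) (𝟎-· y) ⟩
    c xor false        ≡⟨ xor-identityʳ c ⟩
    c                  ∎
    where open ≡-Reasoning

▷-additive : (A : Vec (Word n) k) → Additive (A ▷_)
▷-additive []      = record { homo-𝟎 = refl ; homo-⊕ = λ _ _ → refl }
▷-additive (r ∷ A) = record
  { homo-𝟎 = cong₂ _∷_ (𝟎-· r) (homo-𝟎 (▷-additive A))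
  ; homo-⊕ = λ x y → cong₂ _∷_ (·-distribʳ-⊕ r x y) (homo-⊕ (▷-additive A) x y)
  }

⋆-·-adjoint : (a : Word k) (A : Vec (Word n) k) (v : Word n) → (a ⋆ A) · v ≡ a · (A ▷ v)
⋆-·-adjoint []      []      v = 𝟎-· v
⋆-·-adjoint (b ∷ a) (r ∷ A) v = begin
  (b ⊙ r ⊕ a ⋆ A) · v                ≡⟨ ·-distribʳ-⊕ v (b ⊙ r) (a ⋆ A) ⟩
  (b ⊙ r) · v xor (a ⋆ A) · v        ≡⟨ cong₂ _xor_ (⊙-· b) (⋆-·-adjoint a A v) ⟩
  (b ∧ (v · r)) xor a · (A ▷ v)      ∎
  where
  open ≡-Reasoning
  ⊙-· : ∀ b → (b ⊙ r) · v ≡ b ∧ (v · r)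
  ⊙-· false = trans (cong (_· v) (false-⊙ r)) (𝟎-· v)
  ⊙-· true  = trans (cong (_· v) (true-⊙ r)) (·-comm r v)

identity : Vec (Word k) k
identity {zero}  = []
identity {suc k} = (true ∷ 𝟎) ∷ map (false ∷_) identity

⋆-identity : (a : Word k) → a ⋆ identity ≡ a
⋆-identity []      = refl
⋆-identity (b ∷ a) = begin
  b ⊙ (true ∷ 𝟎) ⊕ a ⋆ map (false ∷_) identity    ≡⟨ cong (b ⊙ (true ∷ 𝟎) ⊕_) (additive-⋆ false∷-additive a identity) ⟨
  b ⊙ (true ∷ 𝟎) ⊕ (false ∷ a ⋆ identity)         ≡⟨ cong₂ _∷_ (trans (xor-identityʳ (b ∧ true)) (∧-identityʳ b)) tail ⟩
  b ∷ a                                           ∎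
  where
  open ≡-Reasoning
  false∷-additive : Additive {n} (false ∷_)
  false∷-additive = record { homo-𝟎 = refl ; homo-⊕ = λ _ _ → refl }
  ⊙-𝟎 : ∀ b → b ⊙ 𝟎 {n} ≡ 𝟎
  ⊙-𝟎 false = false-⊙ 𝟎
  ⊙-𝟎 true  = true-⊙ 𝟎
  tail : b ⊙ 𝟎 ⊕ a ⋆ identity ≡ a
  tail = trans (cong₂ _⊕_ (⊙-𝟎 b) (⋆-identity a)) (⊕-identityˡ a)

transpose-∷ : (r : Word n) (A : Vec (Word n) k) → transpose (r ∷ A) ≡ zipWith _∷_ r (transpose A)
transpose-∷ r A = sym (zipWith-is-⊛ _∷_ r (transpose A))

transpose-▷ : (A : Vec (Word n) k) (v : Word k) → transpose A ▷ v ≡ v ⋆ A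
transpose-▷ {n} [] []      = map-replicate _ _ n
transpose-▷ (r ∷ A) (b ∷ v) = begin
  transpose (r ∷ A) ▷ (b ∷ v)                     ≡⟨ cong (_▷ (b ∷ v)) (transpose-∷ r A) ⟩
  zipWith _∷_ r (transpose A) ▷ (b ∷ v)           ≡⟨ columns r (transpose A) ⟩
  b ⊙ r ⊕ transpose A ▷ v                         ≡⟨ cong (b ⊙ r ⊕_) (transpose-▷ A v) ⟩
  b ⊙ r ⊕ v ⋆ A                                   ∎
  where
  open ≡-Reasoning
  columns : ∀ {n} (r : Word n) B → zipWith _∷_ r B ▷ (b ∷ v) ≡ b ⊙ r ⊕ B ▷ v
  columns []      []      = refl
  columns (c ∷ r) (s ∷ B) = cong (_ ∷_) (columns r B)

-- Both sides are paired with every `a`; adjointness for Aᵀ and for A then meets in `transpose-▷`.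
⋆-transpose : (A : Vec (Word n) k) (v : Word n) → v ⋆ transpose A ≡ A ▷ v
⋆-transpose A v = ·-nondegenerate _ _ λ a → begin
  a · (v ⋆ transpose A)       ≡⟨ ·-comm a (v ⋆ transpose A) ⟩
  (v ⋆ transpose A) · a       ≡⟨ ⋆-·-adjoint v (transpose A) a ⟩
  v · (transpose A ▷ a)       ≡⟨ cong (v ·_) (transpose-▷ A a) ⟩
  v · (a ⋆ A)                 ≡⟨ ·-comm v (a ⋆ A) ⟩
  (a ⋆ A) · v                 ≡⟨ ⋆-·-adjoint a A v ⟩
  a · (A ▷ v)                 ∎
  where open ≡-Reasoning

-- The matrix A Aᵀ.
gram : Vec (Word n) k → Vec (Word k) k
gram A = map (A ▷_) A

gram-identity⇒▷-⋆ : (A : Vec (Word n) k) → gram A ≡ identity → ∀ a → A ▷ (a ⋆ A) ≡ a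
gram-identity⇒▷-⋆ A gram≡I a = begin
  A ▷ (a ⋆ A)      ≡⟨ additive-⋆ (▷-additive A) a A ⟩
  a ⋆ gram A       ≡⟨ cong (a ⋆_) gram≡I ⟩
  a ⋆ identity     ≡⟨ ⋆-identity a ⟩
  a                ∎
  where open ≡-Reasoning

-- Row spaces and systematic generator matrices

rowSpace : Vec (Word n) k → Code n
rowSpace G = record
  { Codeword = λ x → ∃ λ a → a ⋆ G ≡ x
  ; 𝟎-mem    = 𝟎 , homo-𝟎 (⋆-additive G)
  ; ⊕-closed = λ { (a , refl) (b , refl) → a ⊕ b , homo-⊕ (⋆-additive G) a b }
  ; ⊙-closed = λ
    { false {x} _ → 𝟎 , trans (homo-𝟎 (⋆-additive G)) (sym (false-⊙ x))
    ; true {x} x∈C → subst (λ z → ∃ λ a → a ⋆ G ≡ z) (sym (true-⊙ x)) x∈C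
    }
  }

rows∈rowSpace : (G : Vec (Word n) k) → All (Codeword (rowSpace G)) G
rows∈rowSpace []      = []
rows∈rowSpace (r ∷ G) =
  (true ∷ 𝟎 , trans (⋆-true 𝟎 r G) (trans (cong (r ⊕_) (homo-𝟎 (⋆-additive G))) (⊕-identityʳ r))) ∷
  All.map (λ { (a , eq) → false ∷ a , trans (⋆-false a r G) eq }) (rows∈rowSpace G)

systematic : Vec (Word n) k → Vec (Word (k + n)) k
systematic A = zipWith _++_ identity A

⋆-systematic : (A : Vec (Word n) k) (a : Word k) → a ⋆ systematic A ≡ a ++ a ⋆ A
⋆-systematic A a = trans (⋆-zipWith-++ a identity A) (cong (_++ a ⋆ A) (⋆-identity a))
  where
  open ≡-Reasoning
  ⋆-zipWith-++ : ∀ {l m n} (a : Word l) (R : Vec (Word m) l) (S : Vec (Word n) l) →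
                 a ⋆ zipWith _++_ R S ≡ a ⋆ R ++ a ⋆ S
  ⋆-zipWith-++ {m = m} []      []      []      = sym (𝟎-++ m)
  ⋆-zipWith-++ (b ∷ a) (r ∷ R) (s ∷ S) = begin
    b ⊙ (r ++ s) ⊕ a ⋆ zipWith _++_ R S            ≡⟨ cong₂ _⊕_ (map-++ (b ∧_) r s) (⋆-zipWith-++ a R S) ⟩
    (b ⊙ r ++ b ⊙ s) ⊕ (a ⋆ R ++ a ⋆ S)            ≡⟨ zipWith-++ _xor_ (b ⊙ r) (b ⊙ s) (a ⋆ R) (a ⋆ S) ⟩
    (b ⊙ r ⊕ a ⋆ R) ++ (b ⊙ s ⊕ a ⋆ S)             ∎

systematic-isBasis : (A : Vec (Word n) k) → IsBasis (rowSpace (systematic A)) (systematic A)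
systematic-isBasis {k = k} A = record
  { members     = rows∈rowSpace (systematic A)
  -- The left half of a[I | A] is a itself.
  ; independent = λ a eq → ++-injectiveˡ a 𝟎 (trans (sym (⋆-systematic A a)) (trans eq (sym (𝟎-++ k))))
  ; spanning    = λ _ x∈C → x∈C
  }

-- Weights modulo 4 and the shadow

bit : Bool → ℕ
bit b = if b then 1 else 0

weight-𝟎 : ∀ n → weight (𝟎 {n}) ≡ 0
weight-𝟎 zero    = refl
weight-𝟎 (suc n) = weight-𝟎 n

weight-++ : (x : Word m) (y : Word n) → weight (x ++ y) ≡ weight x + weight y
weight-++ []          y = refl
weight-++ (false ∷ x) y = weight-++ x y
weight-++ (true ∷ x)  y = cong suc (weight-++ x y)

common : Word n → Word n → ℕ
common x y = weight (zipWith _∧_ x y)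

-- Inclusion and exclusion, with twice the overlap moved to the left to avoid truncated subtraction.
weight-⊕ : (x y : Word n) → weight (x ⊕ y) + common x y * 2 ≡ weight x + weight y
weight-⊕ []          []          = refl
weight-⊕ (false ∷ x) (false ∷ y) = weight-⊕ x y
weight-⊕ (false ∷ x) (true ∷ y)  = trans (cong suc (weight-⊕ x y)) (sym (+-suc (weight x) (weight y)))
weight-⊕ (true ∷ x)  (false ∷ y) = cong suc (weight-⊕ x y)
weight-⊕ (true ∷ x)  (true ∷ y)  = begin
  weight (x ⊕ y) + suc (suc (common x y * 2))    ≡⟨ +-suc _ _ ⟩
  suc (weight (x ⊕ y) + suc (common x y * 2))    ≡⟨ cong suc (+-suc _ _) ⟩
  2+ (weight (x ⊕ y) + common x y * 2)           ≡⟨ cong 2+ (weight-⊕ x y) ⟩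
  2+ (weight x + weight y)                        ≡⟨ cong suc (+-suc _ _) ⟨
  suc (weight x + suc (weight y))                 ∎
  where open ≡-Reasoning

weight-parity : (x : Word n) → ∃ λ q → weight x ≡ bit (foldr′ _xor_ false x) + q * 2
weight-parity []          = 0 , refl
weight-parity (false ∷ x) = weight-parity x
weight-parity (true ∷ x) with foldr′ _xor_ false x | weight-parity x
... | false | q , eq = q , cong suc eq
... | true  | q , eq = suc q , cong suc eq

common-parity : (x y : Word n) → ∃ λ q → common x y ≡ bit (x · y) + q * 2
common-parity x y = weight-parity (zipWith _∧_ x y)

self-orthogonal⇒even : (x : Word n) → x · x ≡ false → 2 ∣ weight x
self-orthogonal⇒even x x⊥x with common-parity x x
... | q , eq rewrite x⊥x = divides q (trans (cong weight (sym (∧-self x))) eq)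
  where
  ∧-self : (x : Word n) → zipWith _∧_ x x ≡ x
  ∧-self []      = refl
  ∧-self (b ∷ x) = cong₂ _∷_ (∧-idem b) (∧-self x)

-- The condition wt x ≡ 2 (y · x) (mod 4), read as wt x + 2 (y · x) ≡ 0.
Balanced : Word n → Pred (Word n) 0ℓ
Balanced y x = 4 ∣ weight x + bit (y · x) * 2

-- Orthogonality makes the overlap of `x` and `z` even, so the weights add up modulo 4. The doubled
-- bits do too, since two ones give 2 + 2 = 4.
balanced-⊕ : (y x z : Word n) → x · z ≡ false →
             Balanced y x → Balanced y z → Balanced y (x ⊕ z)
balanced-⊕ y x z x⊥z bx bz with common-parity x z
... | q , eq rewrite x⊥z =
  ∣m+n∣m⇒∣n (subst (4 ∣_) rearranged (∣m∣n⇒∣m+n bx bz)) (n∣m*n (q + both (y · x) (y · z)))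
  where
  open ≡-Reasoning
  both : Bool → Bool → ℕ
  both a b = bit (a ∧ b)
  bit-xor : ∀ a b → bit a * 2 + bit b * 2 ≡ bit (a xor b) * 2 + both a b * 4
  bit-xor false false = refl
  bit-xor false true  = refl
  bit-xor true  false = refl
  bit-xor true  true  = refl
  weights : weight x + weight z ≡ weight (x ⊕ z) + q * 4
  weights = begin
    weight x + weight z                  ≡⟨ weight-⊕ x z ⟨
    weight (x ⊕ z) + common x z * 2     ≡⟨ cong (λ o → weight (x ⊕ z) + o * 2) eq ⟩
    weight (x ⊕ z) + q * 2 * 2           ≡⟨ cong (weight (x ⊕ z) +_) (*-assoc q 2 2) ⟩
    weight (x ⊕ z) + q * 4               ∎
  shuffle : ∀ a b c d → (a + b) + (c + d) ≡ (a + c) + (b + d)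
  shuffle = solve 4 (λ a b c d → (a :+ b) :+ (c :+ d) := (a :+ c) :+ (b :+ d)) refl
  collect : ∀ w q e p → (w + q * 4) + (e + p * 4) ≡ (q + p) * 4 + (w + e)
  collect = solve 4 (λ w q e p → (w :+ q :* con 4) :+ (e :+ p :* con 4) := (q :+ p) :* con 4 :+ (w :+ e)) refl
  rearranged : (weight x + bit (y · x) * 2) + (weight z + bit (y · z) * 2) ≡
               (q + both (y · x) (y · z)) * 4 + (weight (x ⊕ z) + bit (y · (x ⊕ z)) * 2)
  rearranged = begin
    (weight x + bit (y · x) * 2) + (weight z + bit (y · z) * 2)
      ≡⟨ shuffle (weight x) _ (weight z) _ ⟩
    (weight x + weight z) + (bit (y · x) * 2 + bit (y · z) * 2)
      ≡⟨ cong₂ _+_ weights (bit-xor (y · x) (y · z)) ⟩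
    (weight (x ⊕ z) + q * 4) + (bit (y · x xor y · z) * 2 + both (y · x) (y · z) * 4)
      ≡⟨ collect (weight (x ⊕ z)) q (bit (y · x xor y · z) * 2) (both (y · x) (y · z)) ⟩
    (q + both (y · x) (y · z)) * 4 + (weight (x ⊕ z) + bit (y · x xor y · z) * 2)
      ≡⟨ cong (λ b → (q + both (y · x) (y · z)) * 4 + (weight (x ⊕ z) + bit b * 2)) (·-distribˡ-⊕ y x z) ⟨
    (q + both (y · x) (y · z)) * 4 + (weight (x ⊕ z) + bit (y · (x ⊕ z)) * 2) ∎

-- Checking the rows suffices: they are added one at a time, each orthogonal to the combination of
-- the later ones.
balanced-⋆ : (y : Word n) (G : Vec (Word n) k) → (∀ a b → (a ⋆ G) · (b ⋆ G) ≡ false) →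
             All (Balanced y) G → ∀ a → Balanced y (a ⋆ G)
balanced-⋆ {n} y [] orth [] [] = subst (4 ∣_) (sym zero-sum) (4 ∣0)
  where
  zero-sum : weight (𝟎 {n}) + bit (y · 𝟎) * 2 ≡ 0
  zero-sum = cong₂ (λ w b → w + bit b * 2) (weight-𝟎 n) (trans (·-comm y 𝟎) (𝟎-· y))
balanced-⋆ y (r ∷ G) orth (br ∷ bG) (b ∷ a) = extend b
  where
  orthG : ∀ a b → (a ⋆ G) · (b ⋆ G) ≡ false
  orthG a b = trans (cong₂ _·_ (sym (⋆-false a r G)) (sym (⋆-false b r G))) (orth (false ∷ a) (false ∷ b))
  r⊥a : r · (a ⋆ G) ≡ false
  r⊥a = trans (cong₂ _·_ (sym r-eq) (sym (⋆-false a r G))) (orth (true ∷ 𝟎) (false ∷ a))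
    where
    r-eq : (true ∷ 𝟎) ⋆ (r ∷ G) ≡ r
    r-eq = trans (⋆-true 𝟎 r G) (trans (cong (r ⊕_) (homo-𝟎 (⋆-additive G))) (⊕-identityʳ r))
  extend : ∀ b → Balanced y ((b ∷ a) ⋆ (r ∷ G))
  extend false = subst (Balanced y) (sym (⋆-false a r G)) (balanced-⋆ y G orthG bG a)
  extend true  = subst (Balanced y) (sym (⋆-true a r G))
                   (balanced-⊕ y r (a ⋆ G) r⊥a br (balanced-⋆ y G orthG bG a))

module _ (C : Code n) (C⊥C : SelfDual C) (y : Word n)
         (balanced : ∀ c → Codeword C c → Balanced y c) where

  -- This and its converse identify C₀ with C ∩ y^⊥.
  balanced⇒doublyEven : ∀ {c} → Codeword C c → y · c ≡ false → doublyEvenSubcode C c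
  balanced⇒doublyEven {c} c∈C y⊥c =
    c∈C , n∣m⇒m%n≡0 (weight c) 4
            (subst (4 ∣_) (trans (cong (λ b → weight c + bit b * 2) y⊥c) (+-identityʳ _)) (balanced c c∈C))

  doublyEven⇒⊥ : ∀ {c} → doublyEvenSubcode C c → y · c ≡ false
  doublyEven⇒⊥ {c} (c∈C , wt%4≡0) with y · c | balanced c c∈C
  ... | false | _    = refl
  -- Here 4 would divide 2.
  ... | true  | 4∣wt+2 with ∣m+n∣m⇒∣n 4∣wt+2 (m%n≡0⇒n∣m (weight c) 4 wt%4≡0)
  ...   | divides zero    ()
  ...   | divides (suc _) ()

  -- If `y` lay in C = C^⊥, every codeword would be doubly even, including the one of weight 2
  -- modulo 4.
  balanced∈shadow : SinglyEven C → shadow C y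
  balanced∈shadow (c , c∈C , wt%4≡2) = (λ x x∈C₀ → doublyEven⇒⊥ x∈C₀) , y∉C
    where
    y∉C : ¬ Codeword C y
    y∉C y∈C = contradiction
      (trans (sym (proj₂ (balanced⇒doublyEven c∈C (proj₁ C⊥C y∈C c c∈C)))) wt%4≡2) λ ()

  -- As a functional on C, `x` vanishes on C₀ = C ∩ y^⊥, of index at most 2, but not on all of C.
  -- Hence it agrees with `y`, and x + y lies in C^⊥ = C.
  shadow⊆coset : ∀ {x} → shadow C x → Codeword C (x ⊕ y)
  shadow⊆coset {x} (x⊥C₀ , x∉C) = proj₂ C⊥C λ c c∈C → begin
    (x ⊕ y) · c          ≡⟨ ·-distribʳ-⊕ c x y ⟩
    (x · c) xor (y · c)  ≡⟨ cong (_xor y · c) (agrees c c∈C) ⟩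
    (y · c) xor (y · c)  ≡⟨ xor-same (y · c) ⟩
    false                ∎
    where
    open ≡-Reasoning
    agrees : ∀ c → Codeword C c → x · c ≡ y · c
    agrees c c∈C with y · c in yc | x · c in xc
    ... | false | _     = trans (sym xc) (x⊥C₀ c (balanced⇒doublyEven c∈C yc))
    ... | true  | true  = refl
    -- Here `x` would vanish on C₀ and on its other coset c + C₀, hence lie in C^⊥ = C.
    ... | true  | false = contradiction (proj₂ C⊥C x⊥C) x∉C
      where
      x⊥C : ∀ c′ → Codeword C c′ → x · c′ ≡ false
      x⊥C c′ c′∈C with y · c′ in yc′
      ... | false = x⊥C₀ c′ (balanced⇒doublyEven c′∈C yc′)
      ... | true  = begin
        x · c′               ≡⟨ cong (_xor (x · c′)) xc ⟨
        (x · c) xor (x · c′) ≡⟨ ·-distribˡ-⊕ x c c′ ⟨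
        x · (c ⊕ c′)         ≡⟨ x⊥C₀ (c ⊕ c′) (balanced⇒doublyEven (Code.⊕-closed C c∈C c′∈C)
                                  (trans (·-distribˡ-⊕ y c c′) (cong₂ _xor_ yc yc′))) ⟩
        false                ∎

  -- For c = x + y, wt x = wt y + wt c - 2|y ∩ c|, and both wt c and 2|y ∩ c| are 2 (y · c) modulo
  -- 4.
  coset-weight : ∀ {x} → Codeword C (x ⊕ y) → ∃ λ p → ∃ λ q → weight x + p * 4 ≡ weight y + q * 4
  coset-weight {x} c∈C with balanced (x ⊕ y) c∈C | common-parity y (x ⊕ y)
  ... | divides q wt≡ | p , eq = bit (y · (x ⊕ y)) + p , q , (begin
    weight x + (b + p) * 4                          ≡⟨ split (weight x) b p ⟩
    (weight x + (b + p * 2) * 2) + b * 2            ≡⟨ cong (λ o → (weight x + o * 2) + b * 2) eq ⟨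
    (weight x + common y c * 2) + b * 2            ≡⟨ cong (λ z → (weight z + common y c * 2) + b * 2) x≡ ⟨
    (weight (y ⊕ c) + common y c * 2) + b * 2      ≡⟨ cong (_+ b * 2) (weight-⊕ y c) ⟩
    (weight y + weight c) + b * 2                   ≡⟨ +-assoc (weight y) (weight c) (b * 2) ⟩
    weight y + (weight c + b * 2)                   ≡⟨ cong (weight y +_) wt≡ ⟩
    weight y + q * 4                                ∎)
    where
    open ≡-Reasoning
    c = x ⊕ y
    b = bit (y · c)
    x≡ : y ⊕ (x ⊕ y) ≡ x
    x≡ = trans (cong (y ⊕_) (⊕-comm x y)) (⊕-cancel y x)
    split : ∀ w b p → w + (b + p) * 4 ≡ (w + (b + p * 2) * 2) + b * 2
    split = solve 3 (λ w b p → w :+ (b :+ p) :* con 4 := (w :+ (b :+ p :* con 2) :* con 2) :+ b :* con 2) refl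

-- Distinct congruent numbers are at least 4 apart. This is why the scans of the coset may ask for
-- weight `s ∸ 3` only.
≡-mod-4⇒≤ : ∀ {w s} p q → w + p * 4 ≡ s + q * 4 → s ≤ 3 + w → s ≤ w
≡-mod-4⇒≤ {w} {s} p q eq s≤3+w = ≮⇒≥ λ w<s → <-irrefl refl (begin-strict
  w + p * 4        ≡⟨ eq ⟩
  s + q * 4        ≤⟨ +-monoˡ-≤ (q * 4) s≤3+w ⟩
  3 + w + q * 4    <⟨ ≤-reflexive (rearrange w q) ⟩
  w + suc q * 4    ≤⟨ +-monoʳ-≤ w (*-monoˡ-≤ 4 (q<p w<s)) ⟩
  w + p * 4        ∎)
  where
  open ≤-Reasoning
  rearrange : ∀ w q → suc (3 + w + q * 4) ≡ w + suc q * 4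
  rearrange = solve 2 (λ w q → con 1 :+ (con 3 :+ w :+ q :* con 4) := w :+ (con 1 :+ q) :* con 4) refl
  q<p : w < s → q < p
  q<p w<s = ≰⇒> λ p≤q → <-irrefl eq (+-mono-<-≤ w<s (*-monoˡ-≤ 4 p≤q))

-- Sums of few rows

-- Searching words in this form is several times faster than searching vectors,
-- which carry their lengths.
data Bits : Set where
  []      : Bits
  O∷_ I∷_ : Bits → Bits

infixr 5 O∷_ I∷_
infixl 6 _⊞_

encode : Word n → Bits
encode []          = []
encode (false ∷ x) = O∷ encode x
encode (true ∷ x)  = I∷ encode x

encodeAll : Vec (Word n) k → List Bits
encodeAll []       = []
encodeAll (r ∷ rs) = encode r ∷ encodeAll rs

_⊞_ : Bits → Bits → Bits
[]     ⊞ _      = []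
(O∷ _) ⊞ []     = []
(I∷ _) ⊞ []     = []
(O∷ x) ⊞ (O∷ y) = O∷ x ⊞ y
(O∷ x) ⊞ (I∷ y) = I∷ x ⊞ y
(I∷ x) ⊞ (O∷ y) = I∷ x ⊞ y
(I∷ x) ⊞ (I∷ y) = O∷ x ⊞ y

heavy : ℕ → Bits → Bool
heavy zero    _      = true
heavy (suc n) []     = false
heavy (suc n) (O∷ x) = heavy (suc n) x
heavy (suc n) (I∷ x) = heavy n x

-- P is asked about every sum of x and j ≤ k rows, with its threshold n lowered
-- by j: the rows come from [I | A], whose left half contributes weight j.
scan : (ℕ → Bits → Bool) → ℕ → ℕ → Bits → List Bits → Bool
scan P k       n x []       = P n x
scan P zero    n x (r ∷ rs) = P n x
scan P (suc k) n x (r ∷ rs) = scan P k (n ∸ 1) (x ⊞ r) rs ∧ scan P (suc k) n x rs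

-- Sums are sorted by their first row, which is charged neither to `k` nor to `n`.
leading : (ℕ → Bits → Bool) → ℕ → ℕ → List Bits → Bool
leading P k n []       = true
leading P k n (r ∷ rs) = scan P k n r rs ∧ leading P k n rs

-- A word is filed under its first `d` bits, and a bucket keeps only the bits after them.
data Trie : ℕ → Set where
  empty  : Trie d
  bucket : List Bits → Trie zero
  node   : Trie d → Trie d → Trie (suc d)

insert : ∀ d → Bits → Trie d → Trie d
insert zero    x      empty       = bucket (x ∷ [])
insert zero    x      (bucket ys) = bucket (x ∷ ys)
insert (suc d) []     t           = t
insert (suc d) (O∷ x) empty       = node (insert d x empty) empty
insert (suc d) (I∷ x) empty       = node empty (insert d x empty)
insert (suc d) (O∷ x) (node l r)  = node (insert d x l) r
insert (suc d) (I∷ x) (node l r)  = node l (insert d x r)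

insertAll : ∀ d → Bits → List Bits → Trie d → Trie d
insertAll d r []       t = t
insertAll d r (p ∷ ps) t = insert d (r ⊞ p) (insertAll d r ps t)

allFar : ℕ → Bits → List Bits → Bool
allFar n x []       = true
allFar n x (y ∷ ys) = heavy n (x ⊞ y) ∧ allFar n x ys

-- `e` is the number of key disagreements still allowed, so only buckets in a Hamming ball around
-- the key of `x` are visited.
query : ℕ → Trie d → ℕ → Bits → Bool
query e       empty       n x      = true
query e       (bucket ys) n x      = allFar n x ys
-- A word shorter than the key gets the safe answer.
query e       (node l r)  n []     = false
query zero    (node l r)  n (O∷ x) = query zero l n x
query zero    (node l r)  n (I∷ x) = query zero r n x
query (suc e) (node l r)  n (O∷ x) = query (suc e) l n x ∧ query e r n x
query (suc e) (node l r)  n (I∷ x) = query (suc e) r n x ∧ query e l n x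

shift : Bits → List Bits → List Bits → List Bits
shift r []       qs = qs
shift r (p ∷ ps) qs = r ⊞ p ∷ shift r ps qs

-- The rows already passed are in use through p₁, p₂ and t, the sums of one, two
-- and three of them. A sum of 4 + j rows is met at its fourth row r, where x runs
-- through the sums of r and j later rows; n ∸ j is the weight it must reach.
meet : ∀ d → ℕ → ℕ → (p₀ p₁ p₂ : List Bits) → Trie d → List Bits → Bool
meet d k n p₀ p₁ p₂ t []       = true
meet d k n p₀ p₁ p₂ t (r ∷ rs) =
  scan (λ n → query (pred n / 4) t n) k n r rs ∧
  meet d k n p₀ (shift r p₀ p₁) (shift r p₁ p₂) (insertAll d r p₂ t) rs

-- The key, on which near agreement is sought, is put in front of each row; the
-- threshold for 4 rows is 13 ∸ 4.
meetBy : (Word n → Word d) → ℕ → Vec (Word n) m → Bool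
meetBy {n = n} {d = d} key k A =
  meet d k 9 (encode (𝟎 {d + n}) ∷ []) [] [] empty (encodeAll (map (λ r → key r ++ r) A))

block : ℕ → Word 41 → Word 10
block 0 x = take 10 x
block 1 x = take 10 (drop 10 x)
block 2 x = take 10 (drop 10 (drop 10 x))
block _ x = take 10 (drop 10 (drop 10 (drop 10 x)))

noLightWord : ℕ → Vec (Word 41) m → Bool
noLightWord k A =
  -- For 1 + j rows with j ≤ 2 the threshold is 12 ∸ j, that is, 13 less the number of rows.
  leading heavy 2 12 (encodeAll A) ∧
  meetBy (block 0) k A ∧ meetBy (block 1) k A ∧ meetBy (block 2) k A ∧ meetBy (block 3) k A

-- Soundness of the searches

encode-⊕ : (x y : Word n) → encode x ⊞ encode y ≡ encode (x ⊕ y)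
encode-⊕ []          []          = refl
encode-⊕ (false ∷ x) (false ∷ y) = cong O∷_ (encode-⊕ x y)
encode-⊕ (false ∷ x) (true ∷ y)  = cong I∷_ (encode-⊕ x y)
encode-⊕ (true ∷ x)  (false ∷ y) = cong I∷_ (encode-⊕ x y)
encode-⊕ (true ∷ x)  (true ∷ y)  = cong O∷_ (encode-⊕ x y)

heavy-sound : ∀ n (x : Word m) → heavy n (encode x) ≡ true → n ≤ weight x
heavy-sound zero    x           h = z≤n
heavy-sound (suc n) (false ∷ x) h = heavy-sound (suc n) x h
heavy-sound (suc n) (true ∷ x)  h = s≤s (heavy-sound n x h)

weight≡0⇒𝟎 : (x : Word n) → weight x ≡ 0 → x ≡ 𝟎
weight≡0⇒𝟎 []          eq = refl
weight≡0⇒𝟎 (false ∷ x) eq = cong (false ∷_) (weight≡0⇒𝟎 x eq)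

-- `P` stays arbitrary to cover both uses, the weight test and the query to the trie.
scan-sound : ∀ {l} P k n (x : Word m) (A : Vec (Word m) l) →
             scan P k n (encode x) (encodeAll A) ≡ true →
             ∀ a → weight a ≤ k → P (n ∸ weight a) (encode (x ⊕ a ⋆ A)) ≡ true
scan-sound P zero n x [] h [] a≤k rewrite ⊕-identityʳ x = h
scan-sound P (suc k) n x [] h [] a≤k rewrite ⊕-identityʳ x = h
scan-sound P zero n x (r ∷ A) h a a≤k
  rewrite n≤0⇒n≡0 a≤k | weight≡0⇒𝟎 a (n≤0⇒n≡0 a≤k)
        | homo-𝟎 (⋆-additive (r ∷ A)) | ⊕-identityʳ x = h
scan-sound P (suc k) n x (r ∷ A) h (false ∷ a) a≤k
  rewrite ⋆-false a r A = scan-sound P (suc k) n x A (∧-conicalʳ _ _ h) a a≤k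
scan-sound P (suc k) n x (r ∷ A) h (true ∷ a) (s≤s a≤k)
  rewrite ⋆-true a r A | sym (⊕-assoc x r (a ⋆ A)) | sym (∸-+-assoc n 1 (weight a)) =
  scan-sound P k (n ∸ 1) (x ⊕ r) A
    (subst (λ z → scan P k (n ∸ 1) z (encodeAll A) ≡ true) (encode-⊕ x r) (∧-conicalˡ _ _ h)) a a≤k

leading-sound : ∀ {l} P k n (A : Vec (Word m) l) → leading P k n (encodeAll A) ≡ true →
                ∀ a {j} → weight a ≡ suc j → j ≤ k → P (n ∸ j) (encode (a ⋆ A)) ≡ true
leading-sound P k n (r ∷ A) h (false ∷ a) eq j≤k
  rewrite ⋆-false a r A = leading-sound P k n A (∧-conicalʳ _ _ h) a eq j≤k
leading-sound P k n (r ∷ A) h (true ∷ a) refl j≤k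
  rewrite ⋆-true a r A = scan-sound P k n r A (∧-conicalˡ _ _ h) a j≤k

Stored : Trie d → Word (d + m) → Set
Stored empty       y           = ⊥
Stored (bucket ys) y           = encode y ∈ ys
Stored (node l r)  (false ∷ y) = Stored l y
Stored (node l r)  (true ∷ y)  = Stored r y

insert-new : ∀ d (y : Word (d + m)) (t : Trie d) → Stored (insert d (encode y) t) y
insert-new zero    y           empty       = here refl
insert-new zero    y           (bucket ys) = here refl
insert-new (suc d) (false ∷ y) empty       = insert-new d y empty
insert-new (suc d) (true ∷ y)  empty       = insert-new d y empty
insert-new (suc d) (false ∷ y) (node l r)  = insert-new d y l
insert-new (suc d) (true ∷ y)  (node l r)  = insert-new d y r

insert-old : ∀ d x (t : Trie d) (y : Word (d + m)) → Stored t y → Stored (insert d x t) y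
insert-old zero    x      (bucket ys) y           st = there st
insert-old (suc d) []     t           y           st = st
insert-old (suc d) (O∷ x) (node l r)  (false ∷ y) st = insert-old d x l y st
insert-old (suc d) (O∷ x) (node l r)  (true ∷ y)  st = st
insert-old (suc d) (I∷ x) (node l r)  (false ∷ y) st = st
insert-old (suc d) (I∷ x) (node l r)  (true ∷ y)  st = insert-old d x r y st

insertAll-old : ∀ d r ps (t : Trie d) (y : Word (d + m)) → Stored t y → Stored (insertAll d r ps t) y
insertAll-old d r []       t y st = st
insertAll-old d r (p ∷ ps) t y st = insert-old d (r ⊞ p) _ y (insertAll-old d r ps t y st)

insertAll-new : ∀ d (r : Word (d + m)) ps (t : Trie d) y → encode y ∈ ps →
                Stored (insertAll d (encode r) ps t) (r ⊕ y)
insertAll-new d r (p ∷ ps) t y (here refl) rewrite encode-⊕ r y = insert-new d (r ⊕ y) _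
insertAll-new d r (p ∷ ps) t y (there y∈)  = insert-old d (encode r ⊞ p) _ (r ⊕ y) (insertAll-new d r ps t y y∈)

shift-old : ∀ r ps qs {y} → y ∈ qs → y ∈ shift r ps qs
shift-old r []       qs y∈ = y∈
shift-old r (p ∷ ps) qs y∈ = there (shift-old r ps qs y∈)

shift-new : ∀ (r : Word m) ps qs y → encode y ∈ ps → encode (r ⊕ y) ∈ shift (encode r) ps qs
shift-new r (p ∷ ps) qs y (here refl) = here (sym (encode-⊕ r y))
shift-new r (p ∷ ps) qs y (there y∈)  = there (shift-new r ps qs y y∈)

allFar-sound : ∀ n (x : Word m) ys → allFar n (encode x) ys ≡ true →
               ∀ y → encode y ∈ ys → n ≤ weight (x ⊕ y)
allFar-sound n x (_ ∷ ys) h y (here refl) =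
  heavy-sound n (x ⊕ y) (subst (λ z → heavy n z ≡ true) (encode-⊕ x y) (∧-conicalˡ _ _ h))
allFar-sound n x (_ ∷ ys) h y (there y∈) = allFar-sound n x ys (∧-conicalʳ _ _ h) y y∈

-- The weight of the key of x + y counts the branches taken against a bit of `x`, and each of these
-- costs one unit of `e`.
query-sound : ∀ {d} e (t : Trie d) n (x : Word (d + m)) → query e t n (encode x) ≡ true →
              ∀ y → Stored t y → weight (take d (x ⊕ y)) ≤ e → n ≤ weight (drop d (x ⊕ y))
query-sound e (bucket ys) n x h y st near = allFar-sound n x ys h y st
query-sound zero    (node l r) n (false ∷ x) h (false ∷ y) st near = query-sound zero l n x h y st near
query-sound zero    (node l r) n (true ∷ x)  h (true ∷ y)  st near = query-sound zero r n x h y st near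
query-sound zero    (node l r) n (false ∷ x) h (true ∷ y)  st ()
query-sound zero    (node l r) n (true ∷ x)  h (false ∷ y) st ()
query-sound (suc e) (node l r) n (false ∷ x) h (false ∷ y) st near =
  query-sound (suc e) l n x (∧-conicalˡ _ _ h) y st near
query-sound (suc e) (node l r) n (false ∷ x) h (true ∷ y)  st (s≤s near) =
  query-sound e r n x (∧-conicalʳ _ _ h) y st near
query-sound (suc e) (node l r) n (true ∷ x)  h (true ∷ y)  st near =
  query-sound (suc e) r n x (∧-conicalˡ _ _ h) y st near
query-sound (suc e) (node l r) n (true ∷ x)  h (false ∷ y) st (s≤s near) =
  query-sound e l n x (∧-conicalʳ _ _ h) y st near

-- The stores of sums of 0, 1, 2 and 3 passed rows form one family, so that a single induction can
-- move a partial sum from each to the next. At the fourth row the query takes over.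
Layer : (p₀ p₁ p₂ : List Bits) → Trie d → ℕ → Word (d + m) → Set
Layer p₀ p₁ p₂ t 0 y = encode y ∈ p₀
Layer p₀ p₁ p₂ t 1 y = encode y ∈ p₁
Layer p₀ p₁ p₂ t 2 y = encode y ∈ p₂
Layer p₀ p₁ p₂ t 3 y = Stored t y
Layer p₀ p₁ p₂ t _ y = ⊥

-- `y` is the sum of the `i` chosen rows already passed, and `a` chooses among the rest. A chosen
-- row joins `y` while i < 3; the fourth one is where the query finds `y` in the trie. For w rows in
-- all, a sum of weight at most 3 + n - w is to be excluded, and the key is allowed a quarter of
-- that.
meet-sound : ∀ {l} d k n p₀ p₁ p₂ (t : Trie d) (A : Vec (Word (d + m)) l) →
             meet d k n p₀ p₁ p₂ t (encodeAll A) ≡ true →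
             ∀ i y → Layer p₀ p₁ p₂ t i y → ∀ a → 4 ≤ i + weight a → i + weight a ≤ 4 + k →
             weight (take d (a ⋆ A ⊕ y)) ≤ (3 + n ∸ (i + weight a)) / 4 →
             4 + n ≤ i + weight a + weight (drop d (a ⋆ A ⊕ y))
-- The rows have run out with at most three chosen, against the lower bound 4.
meet-sound d k n p₀ p₁ p₂ t [] h 3 y lay [] (s≤s (s≤s (s≤s ()))) hi near
meet-sound d k n p₀ p₁ p₂ t [] h 2 y lay [] (s≤s (s≤s ())) hi near
meet-sound d k n p₀ p₁ p₂ t [] h 1 y lay [] (s≤s ()) hi near
meet-sound d k n p₀ p₁ p₂ t (r ∷ A) h i y lay (false ∷ a) lo hi near
  rewrite ⋆-false a r A =
  meet-sound d k n _ _ _ _ A (∧-conicalʳ _ _ h) i y (persist i lay) a lo hi near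
  where
  persist : ∀ i → Layer p₀ p₁ p₂ t i y →
            Layer p₀ (shift (encode r) p₀ p₁) (shift (encode r) p₁ p₂) (insertAll d (encode r) p₂ t) i y
  persist 0 y∈ = y∈
  persist 1 y∈ = shift-old (encode r) p₀ p₁ y∈
  persist 2 y∈ = shift-old (encode r) p₁ p₂ y∈
  persist 3 y∈ = insertAll-old d (encode r) p₂ t y y∈
-- `r` is the fourth chosen row, so 4 cancels on both sides and `weight a` counts the rows after it.
meet-sound d k n p₀ p₁ p₂ t (r ∷ A) h 3 y lay (true ∷ a) lo (s≤s (s≤s (s≤s (s≤s a≤k)))) near
  rewrite ⋆-true a r A = +-monoʳ-≤ 4 (begin
    n                                                ≤⟨ m≤n+m∸n n (weight a) ⟩
    weight a + (n ∸ weight a)                        ≤⟨ +-monoʳ-≤ (weight a) far ⟩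
    weight a + weight (drop d ((r ⊕ a ⋆ A) ⊕ y))     ∎)
  where
  open ≤-Reasoning
  far : n ∸ weight a ≤ weight (drop d ((r ⊕ a ⋆ A) ⊕ y))
  far = query-sound (pred (n ∸ weight a) / 4) t (n ∸ weight a) (r ⊕ a ⋆ A)
          (scan-sound (λ n → query (pred n / 4) t n) k n r A (∧-conicalˡ _ _ h) a a≤k) y lay
          (subst (λ e → weight (take d ((r ⊕ a ⋆ A) ⊕ y)) ≤ e / 4) (sym (pred[m∸n]≡m∸[1+n] n (weight a))) near)
-- From here on `r` moves from the combination to the partial sum.
meet-sound d k n p₀ p₁ p₂ t (r ∷ A) h 2 y lay (true ∷ a) lo hi near
  rewrite ⋆-true a r A | ⊕.xy∙z≈y∙xz r (a ⋆ A) y =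
  meet-sound d k n _ _ _ _ A (∧-conicalʳ _ _ h) 3 (r ⊕ y) (insertAll-new d r p₂ t y lay) a lo hi near
meet-sound d k n p₀ p₁ p₂ t (r ∷ A) h 1 y lay (true ∷ a) lo hi near
  rewrite ⋆-true a r A | ⊕.xy∙z≈y∙xz r (a ⋆ A) y =
  meet-sound d k n _ _ _ _ A (∧-conicalʳ _ _ h) 2 (r ⊕ y) (shift-new r p₁ p₂ y lay) a lo hi near
meet-sound d k n p₀ p₁ p₂ t (r ∷ A) h 0 y lay (true ∷ a) lo hi near
  rewrite ⋆-true a r A | ⊕.xy∙z≈y∙xz r (a ⋆ A) y =
  meet-sound d k n _ _ _ _ A (∧-conicalʳ _ _ h) 1 (r ⊕ y) (shift-new r p₀ p₁ y lay) a lo hi near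

take-++ : (x : Word m) (y : Word n) → take m (x ++ y) ≡ x
take-++ {m} x y = ++-injectiveˡ (take m (x ++ y)) x (take++drop≡id m (x ++ y))

drop-++ : (x : Word m) (y : Word n) → drop m (x ++ y) ≡ y
drop-++ {m} x y = ++-injectiveʳ (take m (x ++ y)) x (take++drop≡id m (x ++ y))

meetBy-sound : {key : Word n → Word d} → Additive key → ∀ k (A : Vec (Word n) m) → meetBy key k A ≡ true →
               ∀ a → 4 ≤ weight a → weight a ≤ 4 + k → weight (key (a ⋆ A)) ≤ (12 ∸ weight a) / 4 →
               13 ≤ weight a + weight (a ⋆ A)
meetBy-sound {d = d} {key = key} key⁺ k A h a lo hi near =
  subst (λ z → 13 ≤ weight a + weight z) (trans (cong (drop d) keyed) (drop-++ (key v) v))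
    (meet-sound d k 9 _ _ _ _ (map (λ r → key r ++ r) A) h 0 𝟎 (here refl) a lo hi
      (subst (λ z → weight z ≤ (12 ∸ weight a) / 4) (sym (trans (cong (take d) keyed) (take-++ (key v) v))) near))
  where
  v = a ⋆ A
  keyed : a ⋆ map (λ r → key r ++ r) A ⊕ 𝟎 ≡ key v ++ v
  -- Prefixing the key is additive, so the combination of keyed rows is the sum behind its own key.
  keyed = trans (⊕-identityʳ _) (sym (additive-⋆ (++-additive key⁺ id-additive) a A))

block-additive : ∀ i → Additive (block i)
block-additive 0 = take-additive 10
block-additive 1 = ∘-additive (take-additive 10) (drop-additive 10)
block-additive 2 = ∘-additive (take-additive 10) (∘-additive (drop-additive 10) (drop-additive 10))
block-additive (suc (suc (suc _))) =
  ∘-additive (take-additive 10) (∘-additive (drop-additive 10) (∘-additive (drop-additive 10) (drop-additive 10)))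

weight-take-drop : ∀ m (x : Word (m + n)) → weight x ≡ weight (take m x) + weight (drop m x)
weight-take-drop m x = trans (cong weight (sym (take++drop≡id m x))) (weight-++ (take m x) (drop m x))

-- The last of the 41 coordinates belongs to no block, hence an inequality.
block-weights : ∀ x → weight (block 0 x) + (weight (block 1 x) + (weight (block 2 x) + weight (block 3 x))) ≤ weight x
block-weights x = begin
  weight (block 0 x) + (weight (block 1 x) + (weight (block 2 x) + weight (block 3 x)))
    ≤⟨ +-monoʳ-≤ (weight (block 0 x)) (+-monoʳ-≤ (weight (block 1 x)) (+-monoʳ-≤ (weight (block 2 x)) (m≤m+n _ _))) ⟩
  weight (block 0 x) + (weight (block 1 x) + (weight (block 2 x) + (weight (block 3 x) + weight (drop 10 x₃))))
    ≡⟨ cong (λ w → weight (block 0 x) + (weight (block 1 x) + (weight (block 2 x) + w))) (weight-take-drop 10 x₃) ⟨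
  weight (block 0 x) + (weight (block 1 x) + (weight (block 2 x) + weight x₃))
    ≡⟨ cong (λ w → weight (block 0 x) + (weight (block 1 x) + w)) (weight-take-drop 10 x₂) ⟨
  weight (block 0 x) + (weight (block 1 x) + weight x₂)
    ≡⟨ cong (weight (block 0 x) +_) (weight-take-drop 10 x₁) ⟨
  weight (block 0 x) + weight x₁
    ≡⟨ weight-take-drop 10 x ⟨
  weight x ∎
  where
  open ≤-Reasoning
  x₁ : Word 31
  x₁ = drop 10 x
  x₂ : Word 21
  x₂ = drop 10 x₁
  x₃ : Word 11
  x₃ = drop 10 x₂

m<[1+m/n]*n : ∀ m n .{{_ : NonZero n}} → m < suc (m / n) * n
m<[1+m/n]*n m n = begin-strict
  m                      ≡⟨ m≡m%n+[m/n]*n m n ⟩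
  m % n + m / n * n      <⟨ +-monoˡ-< (m / n * n) (m%n<n m n) ⟩
  n + m / n * n          ∎
  where open ≤-Reasoning

-- Up to three rows are enumerated outright. For more, either some block weighs at most (12 ∸ wt a)
-- / 4 and its search applies, or all four exceed this and the sum is heavy anyway.
noLightWord-sound : ∀ k (A : Vec (Word 41) m) → noLightWord k A ≡ true →
                    ∀ a → a ≢ 𝟎 → weight a ≤ 4 + k → 13 ≤ weight a + weight (a ⋆ A)
noLightWord-sound k A h a a≢𝟎 hi = cases (weight a) refl
  where
  open ≤-Reasoning
  v = a ⋆ A
  e = (12 ∸ weight a) / 4

  few : ∀ {j} → weight a ≡ suc j → j ≤ 2 → 13 ≤ suc j + weight v
  few {j} eq j≤2 = s≤s (begin
    12               ≤⟨ m≤n+m∸n 12 j ⟩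
    j + (12 ∸ j)     ≤⟨ +-monoʳ-≤ j (heavy-sound (12 ∸ j) v
                          (leading-sound heavy 2 12 A (∧-conicalˡ _ _ h) a eq j≤2)) ⟩
    j + weight v     ∎)

  many : 4 ≤ weight a → 13 ≤ weight a + weight v
  many lo with ∧-conicalʳ (leading heavy 2 12 (encodeAll A)) _ h
  ... | h₀ with ∧-conicalʳ (meetBy (block 0) k A) _ h₀
  ...   | h₁ with ∧-conicalʳ (meetBy (block 1) k A) _ h₁
  ...     | h₂ with ∧-conicalʳ (meetBy (block 2) k A) _ h₂
  ...       | h₃ with weight (block 0 v) ≤? e | weight (block 1 v) ≤? e
                    | weight (block 2 v) ≤? e | weight (block 3 v) ≤? e
  ... | yes w | _ | _ | _ = meetBy-sound (block-additive 0) k A (∧-conicalˡ _ _ h₀) a lo hi w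
  ... | _ | yes w | _ | _ = meetBy-sound (block-additive 1) k A (∧-conicalˡ _ _ h₁) a lo hi w
  ... | _ | _ | yes w | _ = meetBy-sound (block-additive 2) k A (∧-conicalˡ _ _ h₂) a lo hi w
  ... | _ | _ | _ | yes w = meetBy-sound (block-additive 3) k A h₃ a lo hi w
  ... | no w₀ | no w₁ | no w₂ | no w₃ = begin-strict
    12                           ≤⟨ m≤n+m∸n 12 (weight a) ⟩
    weight a + (12 ∸ weight a)   <⟨ +-monoʳ-< (weight a) (m<[1+m/n]*n (12 ∸ weight a) 4) ⟩
    weight a + suc e * 4         ≡⟨ cong (weight a +_) (fourfold (suc e)) ⟩
    weight a + (suc e + (suc e + (suc e + suc e)))
      ≤⟨ +-monoʳ-≤ (weight a) (+-mono-≤ (≰⇒> w₀) (+-mono-≤ (≰⇒> w₁) (+-mono-≤ (≰⇒> w₂) (≰⇒> w₃)))) ⟩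
    weight a + (weight (block 0 v) + (weight (block 1 v) + (weight (block 2 v) + weight (block 3 v))))
      ≤⟨ +-monoʳ-≤ (weight a) (block-weights v) ⟩
    weight a + weight v          ∎
    where
    fourfold : ∀ x → x * 4 ≡ x + (x + (x + x))
    fourfold = solve 1 (λ x → x :* con 4 := x :+ (x :+ (x :+ x))) refl

  cases : ∀ w → weight a ≡ w → 13 ≤ weight a + weight v
  cases zero    eq = contradiction (weight≡0⇒𝟎 a eq) a≢𝟎
  cases (suc j) eq with j ≤? 2
  ... | yes j≤2 = subst (λ w → 13 ≤ w + weight v) (sym eq) (few eq j≤2)
  ... | no  j≰2 = many (subst (4 ≤_) (sym eq) (s≤s (≰⇒> j≰2)))

-- Self-duality of the code of [I | A]

module _ (A : Vec (Word k) k) (gram-A : gram A ≡ identity) (gram-Aᵀ : gram (transpose A) ≡ identity) where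

  private
    Aᵀ = transpose A
    C = rowSpace (systematic A)

  -- A Aᵀ = I gives this inverse, Aᵀ A = I the other.
  ⋆-inverseˡ : ∀ a → (a ⋆ A) ⋆ Aᵀ ≡ a
  ⋆-inverseˡ a = trans (⋆-transpose A (a ⋆ A)) (gram-identity⇒▷-⋆ A gram-A a)

  ⋆-inverseʳ : ∀ b → (b ⋆ Aᵀ) ⋆ A ≡ b
  ⋆-inverseʳ b = trans (sym (transpose-▷ A (b ⋆ Aᵀ))) (gram-identity⇒▷-⋆ Aᵀ gram-Aᵀ b)

  -- A preserves inner products, so the two halves contribute equally and cancel.
  systematic-⊥ : ∀ a b → (a ⋆ systematic A) · (b ⋆ systematic A) ≡ false
  systematic-⊥ a b = begin
    (a ⋆ systematic A) · (b ⋆ systematic A)   ≡⟨ cong₂ _·_ (⋆-systematic A a) (⋆-systematic A b) ⟩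
    (a ++ a ⋆ A) · (b ++ b ⋆ A)               ≡⟨ ·-++ a b (a ⋆ A) (b ⋆ A) ⟩
    (a · b) xor ((a ⋆ A) · (b ⋆ A))           ≡⟨ cong ((a · b) xor_) (⋆-·-adjoint a A (b ⋆ A)) ⟩
    (a · b) xor (a · (A ▷ (b ⋆ A)))           ≡⟨ cong (λ z → (a · b) xor (a · z)) (gram-identity⇒▷-⋆ A gram-A b) ⟩
    (a · b) xor (a · b)                       ≡⟨ xor-same (a · b) ⟩
    false                                     ∎
    where open ≡-Reasoning

  -- If (l, r) is orthogonal to every (a, aA), then a · l = a · (r Aᵀ) for all a. So l = r Aᵀ, hence
  -- r = lA and (l, r) = l[I | A].
  systematic-selfDual : SelfDual C
  systematic-selfDual = (λ { (a , refl) _ (b , refl) → systematic-⊥ a b }) , λ {x} → ⊥⊆C x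
    where
    open ≡-Reasoning
    xor-false : ∀ b c → b xor c ≡ false → b ≡ c
    xor-false false false _ = refl
    xor-false true  true  _ = refl
    ⊥⊆C : ∀ x → (Codeword C ^⊥) x → Codeword C x
    ⊥⊆C x x⊥C = l , (begin
      l ⋆ systematic A    ≡⟨ ⋆-systematic A l ⟩
      l ++ l ⋆ A          ≡⟨ cong (l ++_) (trans (cong (_⋆ A) l≡) (⋆-inverseʳ r)) ⟩
      l ++ r              ≡⟨ take++drop≡id k x ⟩
      x                   ∎)
      where
      l r : Word k
      l = take k x
      r = drop k x
      l≡ : l ≡ r ⋆ Aᵀ
      l≡ = ·-nondegenerate l (r ⋆ Aᵀ) λ a → xor-false _ _ (begin
        (a · l) xor (a · (r ⋆ Aᵀ))           ≡⟨ cong₂ _xor_ (·-comm a l) (cong (a ·_) (⋆-transpose A r)) ⟩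
        (l · a) xor (a · (A ▷ r))            ≡⟨ cong ((l · a) xor_) (⋆-·-adjoint a A r) ⟨
        (l · a) xor ((a ⋆ A) · r)            ≡⟨ cong ((l · a) xor_) (·-comm (a ⋆ A) r) ⟩
        (l · a) xor (r · (a ⋆ A))            ≡⟨ ·-++ l a r (a ⋆ A) ⟨
        (l ++ r) · (a ++ a ⋆ A)              ≡⟨ cong₂ _·_ (take++drop≡id k x) (sym (⋆-systematic A a)) ⟩
        x · (a ⋆ systematic A)               ≡⟨ x⊥C (a ⋆ systematic A) (a , refl) ⟩
        false                                ∎)

-- Certificates and what they establish

does⇒ : {P : Set} (P? : Dec P) → does P? ≡ true → P
does⇒ P? eq = invert (subst (Reflects _) eq (proof P?))

_≟ᵐ_ : (A B : Vec (Word n) k) → Dec (A ≡ B)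
_≟ᵐ_ = ≡-dec (≡-dec _≟_)

-- The code [I | A] and its shadow vector (yˡ , yʳ).
record Certificate (A : Vec (Word 41) 41) (s : ℕ) : Set where
  field
    gram-A≟I        : does (gram A ≟ᵐ identity) ≡ true
    gram-Aᵀ≟I       : does (gram (transpose A) ≟ᵐ identity) ≡ true
    noLightWord-A   : noLightWord 2 A ≡ true
    noLightWord-Aᵀ  : noLightWord 1 (transpose A) ≡ true
    message         : Word 41
    message-weight  : weight (message ⋆ systematic A) ≡ 14
    yˡ yʳ           : Word 41
    y-weight        : weight (yˡ ++ yʳ) ≡ s
    y-balanced      : does (All.all? (λ c → 4 ∣? weight c + bit ((yˡ ++ yʳ) · c) * 2) (systematic A)) ≡ true
    radius          : ℕ
    s≤5+radius*2    : s ≤ 5 + radius * 2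
    scan-A          : scan heavy radius (s ∸ 3) (encode (yʳ ⊕ yˡ ⋆ A)) (encodeAll A) ≡ true
    scan-Aᵀ         : scan heavy radius (s ∸ 3) (encode (yˡ ⊕ yʳ ⋆ transpose A)) (encodeAll (transpose A)) ≡ true

module _ {A : Vec (Word 41) 41} {s : ℕ} (certificate : Certificate A s) where

  open Certificate certificate

  private
    Aᵀ = transpose A
    C = rowSpace (systematic A)
    y = yˡ ++ yʳ
    gram-A = does⇒ (gram A ≟ᵐ identity) gram-A≟I
    gram-Aᵀ = does⇒ (gram Aᵀ ≟ᵐ identity) gram-Aᵀ≟I
    C⊥C = systematic-selfDual A gram-A gram-Aᵀ

  13≤weight : ∀ a → a ≢ 𝟎 → 13 ≤ weight a + weight (a ⋆ A)
  13≤weight a a≢𝟎 with weight a ≤? 6 | weight (a ⋆ A) ≤? 5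
  -- `noLightWord k` covers sums of up to 4 + k rows: six of A and five of Aᵀ. Beyond both limits
  -- the weight is at least 7 + 6 = 13.
  ... | yes a≤6 | _       = noLightWord-sound 2 A noLightWord-A a a≢𝟎 a≤6
  ... | no  a≰6 | no b≰5  = +-mono-≤ (≰⇒> a≰6) (≰⇒> b≰5)
  ... | no  _   | yes b≤5 = begin
    13                                     ≤⟨ noLightWord-sound 1 Aᵀ noLightWord-Aᵀ (a ⋆ A) b≢𝟎 b≤5 ⟩
    weight (a ⋆ A) + weight ((a ⋆ A) ⋆ Aᵀ) ≡⟨ cong (λ z → weight (a ⋆ A) + weight z) (⋆-inverseˡ A gram-A gram-Aᵀ a) ⟩
    weight (a ⋆ A) + weight a              ≡⟨ +-comm (weight (a ⋆ A)) (weight a) ⟩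
    weight a + weight (a ⋆ A)              ∎
    where
    open ≤-Reasoning
    b≢𝟎 : a ⋆ A ≢ 𝟎
    b≢𝟎 eq = a≢𝟎 (trans (sym (⋆-inverseˡ A gram-A gram-Aᵀ a)) (trans (cong (_⋆ Aᵀ) eq) (homo-𝟎 (⋆-additive Aᵀ))))

  14≤weight : ∀ {x} → Codeword C x → x ≢ 𝟎 → 14 ≤ weight x
  14≤weight (a , refl) x≢𝟎 = even (self-orthogonal⇒even (a ⋆ systematic A) (systematic-⊥ A gram-A gram-Aᵀ a a)) (begin
    13                           ≤⟨ 13≤weight a a≢𝟎 ⟩
    weight a + weight (a ⋆ A)    ≡⟨ weight-++ a (a ⋆ A) ⟨
    weight (a ++ a ⋆ A)          ≡⟨ cong weight (⋆-systematic A a) ⟨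
    weight (a ⋆ systematic A)    ∎)
    where
    open ≤-Reasoning
    a≢𝟎 : a ≢ 𝟎
    a≢𝟎 a≡𝟎 = x≢𝟎 (trans (cong (_⋆ systematic A) a≡𝟎) (homo-𝟎 (⋆-additive (systematic A))))
    even : ∀ {w} → 2 ∣ w → 13 ≤ w → 14 ≤ w
    -- 13 ≤ q * 2 is 6 * 2 < q * 2, whence 7 ≤ q.
    even (divides q refl) 13≤w = *-monoˡ-≤ 2 (*-cancelʳ-< 2 6 q 13≤w)

  word₁₄ : Word 82
  word₁₄ = message ⋆ systematic A

  isCode : IsCode[ 82 , 41 , 14 ] C
  isCode = record
    { dimension     = systematic A , systematic-isBasis A
    ; minimumWeight = (word₁₄ , ((message , refl) , word≢𝟎) , message-weight) ,
                      λ { x (x∈C , x≢𝟎) → 14≤weight x∈C x≢𝟎 }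
    }
    where
    word≢𝟎 : word₁₄ ≢ 𝟎
    word≢𝟎 eq = contradiction (trans (sym message-weight) (trans (cong weight eq) (weight-𝟎 82))) λ ()

  -- The word of minimum weight serves again, as 14 is 2 modulo 4.
  singlyEven : SinglyEven C
  singlyEven = word₁₄ , (message , refl) , cong (_% 4) message-weight

  balanced : ∀ c → Codeword C c → Balanced y c
  balanced _ (a , refl) = balanced-⋆ y (systematic A) (systematic-⊥ A gram-A gram-Aᵀ) rows a
    where
    rows : All (Balanced y) (systematic A)
    rows = does⇒ (All.all? (λ c → 4 ∣? weight c + bit (y · c) * 2) (systematic A)) y-balanced

  scan-bound : (B : Vec (Word 41) 41) (z b : Word 41) →
               scan heavy radius (s ∸ 3) (encode z) (encodeAll B) ≡ true →
               weight b ≤ radius → s ≤ 3 + (weight b + weight (z ⊕ b ⋆ B))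
  scan-bound B z b h b≤radius = begin
    s                                              ≤⟨ m≤n+m∸n s 3 ⟩
    3 + (s ∸ 3)                                    ≤⟨ +-monoʳ-≤ 3 (m≤n+m∸n (s ∸ 3) (weight b)) ⟩
    3 + (weight b + (s ∸ 3 ∸ weight b))            ≤⟨ +-monoʳ-≤ 3 (+-monoʳ-≤ (weight b) far) ⟩
    3 + (weight b + weight (z ⊕ b ⋆ B))            ∎
    where
    open ≤-Reasoning
    far : s ∸ 3 ∸ weight b ≤ weight (z ⊕ b ⋆ B)
    far = heavy-sound (s ∸ 3 ∸ weight b) (z ⊕ b ⋆ B) (scan-sound heavy radius (s ∸ 3) z B h b b≤radius)

  -- In a word (l, r) of the coset, l determines r as (yʳ + yˡ A) + lA, and r determines l likewise
  -- through Aᵀ. So a half of weight at most `radius` puts the word into one of the two scans.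
  coset-bound : ∀ l r → r ⊕ yʳ ≡ (l ⊕ yˡ) ⋆ A → s ≤ 3 + (weight l + weight r)
  coset-bound l r eq with weight l ≤? radius | weight r ≤? radius
  ... | yes l≤radius | _ =
    subst (λ z → s ≤ 3 + (weight l + weight z)) r≡ (scan-bound A (yʳ ⊕ yˡ ⋆ A) l scan-A l≤radius)
    where
    open ≡-Reasoning
    r≡ : (yʳ ⊕ yˡ ⋆ A) ⊕ l ⋆ A ≡ r
    r≡ = begin
      (yʳ ⊕ yˡ ⋆ A) ⊕ l ⋆ A    ≡⟨ ⊕-assoc yʳ (yˡ ⋆ A) (l ⋆ A) ⟩
      yʳ ⊕ (yˡ ⋆ A ⊕ l ⋆ A)    ≡⟨ cong (yʳ ⊕_) (⊕-comm (yˡ ⋆ A) (l ⋆ A)) ⟩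
      yʳ ⊕ (l ⋆ A ⊕ yˡ ⋆ A)    ≡⟨ cong (yʳ ⊕_) (homo-⊕ (⋆-additive A) l yˡ) ⟨
      yʳ ⊕ (l ⊕ yˡ) ⋆ A        ≡⟨ cong (yʳ ⊕_) eq ⟨
      yʳ ⊕ (r ⊕ yʳ)            ≡⟨ cong (yʳ ⊕_) (⊕-comm r yʳ) ⟩
      yʳ ⊕ (yʳ ⊕ r)            ≡⟨ ⊕-cancel yʳ r ⟩
      r                        ∎
  ... | no _ | yes r≤radius =
    subst (λ w → s ≤ 3 + w) (+-comm (weight r) (weight l))
      (subst (λ z → s ≤ 3 + (weight r + weight z)) l≡ (scan-bound Aᵀ (yˡ ⊕ yʳ ⋆ Aᵀ) r scan-Aᵀ r≤radius))
    where
    open ≡-Reasoning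
    l≡ : (yˡ ⊕ yʳ ⋆ Aᵀ) ⊕ r ⋆ Aᵀ ≡ l
    l≡ = begin
      (yˡ ⊕ yʳ ⋆ Aᵀ) ⊕ r ⋆ Aᵀ    ≡⟨ ⊕-assoc yˡ (yʳ ⋆ Aᵀ) (r ⋆ Aᵀ) ⟩
      yˡ ⊕ (yʳ ⋆ Aᵀ ⊕ r ⋆ Aᵀ)    ≡⟨ cong (yˡ ⊕_) (⊕-comm (yʳ ⋆ Aᵀ) (r ⋆ Aᵀ)) ⟩
      yˡ ⊕ (r ⋆ Aᵀ ⊕ yʳ ⋆ Aᵀ)    ≡⟨ cong (yˡ ⊕_) (homo-⊕ (⋆-additive Aᵀ) r yʳ) ⟨
      yˡ ⊕ (r ⊕ yʳ) ⋆ Aᵀ         ≡⟨ cong (λ z → yˡ ⊕ z ⋆ Aᵀ) eq ⟩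
      yˡ ⊕ ((l ⊕ yˡ) ⋆ A) ⋆ Aᵀ   ≡⟨ cong (yˡ ⊕_) (⋆-inverseˡ A gram-A gram-Aᵀ (l ⊕ yˡ)) ⟩
      yˡ ⊕ (l ⊕ yˡ)              ≡⟨ cong (yˡ ⊕_) (⊕-comm l yˡ) ⟩
      yˡ ⊕ (yˡ ⊕ l)              ≡⟨ ⊕-cancel yˡ l ⟩
      l                          ∎
  -- Two halves heavier than `radius` weigh at least 2 * `radius` + 2 together, hence at least
  -- `s ∸ 3`.
  ... | no l≰radius | no r≰radius = begin
    s                                    ≤⟨ s≤5+radius*2 ⟩
    5 + radius * 2                       ≡⟨ cong (5 +_) (double radius) ⟩
    5 + (radius + radius)                ≡⟨ cong (4 +_) (+-suc radius radius) ⟨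
    3 + (suc radius + suc radius)        ≤⟨ +-monoʳ-≤ 3 (+-mono-≤ (≰⇒> l≰radius) (≰⇒> r≰radius)) ⟩
    3 + (weight l + weight r)            ∎
    where
    open ≤-Reasoning
    double : ∀ n → n * 2 ≡ n + n
    double n = trans (*-comm n 2) (cong (n +_) (+-identityʳ n))

  shadow-bound : ∀ x → shadow C x → s ≤ weight x
  shadow-bound x x∈S with shadow⊆coset C C⊥C y balanced x∈S
  ... | c∈C@(a , a⋆G≡x⊕y) with coset-weight C C⊥C y balanced {x} c∈C
  -- The congruence of weights closes the gap of 3 left by `coset-bound`.
  ...   | p , q , wt≡ = ≡-mod-4⇒≤ p q (trans wt≡ (cong (_+ q * 4) y-weight))
    (subst (λ w → s ≤ 3 + w) (sym (weight-take-drop 41 x)) (coset-bound l r r⊕yʳ≡))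
    where
    l r : Word 41
    l = take 41 x
    r = drop 41 x
    split : a ++ a ⋆ A ≡ (l ⊕ yˡ) ++ (r ⊕ yʳ)
    split = begin
      a ++ a ⋆ A                  ≡⟨ ⋆-systematic A a ⟨
      a ⋆ systematic A            ≡⟨ a⋆G≡x⊕y ⟩
      x ⊕ y                       ≡⟨ cong (_⊕ y) (take++drop≡id 41 x) ⟨
      (l ++ r) ⊕ y                ≡⟨ zipWith-++ _xor_ l r yˡ yʳ ⟩
      (l ⊕ yˡ) ++ (r ⊕ yʳ)        ∎
      where open ≡-Reasoning
    r⊕yʳ≡ : r ⊕ yʳ ≡ (l ⊕ yˡ) ⋆ A
    r⊕yʳ≡ = trans (sym (++-injectiveʳ a (l ⊕ yˡ) split)) (cong (_⋆ A) (++-injectiveˡ a (l ⊕ yˡ) split))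

  certified : ∃ λ (C : Code 82) →
              IsCode[ 82 , 41 , 14 ] C × SelfDual C × SinglyEven C × SmallestWeight (shadow C) s
  certified = C , isCode , C⊥C , singlyEven ,
              (y , balanced∈shadow C C⊥C y balanced singlyEven , y-weight) , shadow-bound

-- The four codes

-- Least significant bit first.
word : ∀ n → ℕ → Word n
word zero    x = []
word (suc n) x = (x % 2 ≡ᵇ 1) ∷ word n (x / 2)

-- Let D be the extremal doubly even [80,40,16] code [I₄₀ | bordered circulant]
-- with circulant polynomial 0xd36af77a2, and v a vector of weight 3 (mod 4) in a
-- coset of D of minimum weight 13, invariant under an automorphism of order 13.
-- With D₀ = D ∩ v^⊥ and C₀ = (D₀, 0) ∪ (v + D₀, 1), this code is
-- (C₀, 0) ∪ (𝟏 + C₀, 1), written on permuted coordinates.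
A₁ : Vec (Word 41) 41
A₁ = map (word 41)
  ( 0x0edb6db6db6 ∷ 0x00d36af77a3 ∷ 0x19a6d5eef45 ∷ 0x1b4dabdde89 ∷ 0x069b57bbd11 ∷ 0x0c123d3e869
  ∷ 0x0b49cca660b ∷ 0x04dabdde887 ∷ 0x0891e9f4345 ∷ 0x1b6af77a21b ∷ 0x06d5eef4435 ∷ 0x0c8f4fa1a21
  ∷ 0x0a73299829b ∷ 0x06af77a21a7 ∷ 0x0c7a7d0d105 ∷ 0x0b994cc14d3 ∷ 0x057bbd10d37 ∷ 0x0bd3e868825
  ∷ 0x1deef4434db ∷ 0x12f97acfbfd ∷ 0x1fbbd10d36b ∷ 0x0e53305349d ∷ 0x17cbd67dfe3 ∷ 0x0cfa1a2091f
  ∷ 0x0a99829a4e7 ∷ 0x077a21a6d5f ∷ 0x0fd0d1048f5 ∷ 0x0ccc14d2733 ∷ 0x12f59f7f8bf ∷ 0x1fa21a6d5ef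
  ∷ 0x0e60a693995 ∷ 0x17acfbfc5f3 ∷ 0x0c344123d3f ∷ 0x0b05349cca7 ∷ 0x04434dabddf ∷ 0x09a2091e9f5
  ∷ 0x190d36af77b ∷ 0x021a6d5eef5 ∷ 0x1c34dabdde9 ∷ 0x094d2732999 ∷ 0x11249249248
  ∷ [] )

certificate₁ : Certificate A₁ 1
certificate₁ = record
  { gram-A≟I       = refl
  ; gram-Aᵀ≟I      = refl
  ; noLightWord-A  = refl
  ; noLightWord-Aᵀ = refl
  -- This selects the last row of `A₁`, of weight 13.
  ; message        = word 41 0x10000000000
  ; message-weight = refl
  -- The last unit vector: the codewords of weight 2 modulo 4 are those with a one there.
  ; yˡ             = word 41 0x0
  ; yʳ             = word 41 0x10000000000
  ; y-weight       = refl
  ; y-balanced     = refl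
  -- `s ∸ 3` is 0, so the scans hold trivially.
  ; radius         = 0
  ; s≤5+radius*2   = m≤m+n 1 4
  ; scan-A         = refl
  ; scan-Aᵀ        = refl
  }

-- A neighbour of the code of A₁, up to a permutation of coordinates: for a
-- 4-set u that misses the last coordinate e and that no word of weight 14 meets
-- in exactly three points, (C ∩ u^⊥) ∪ (u + (C ∖ u^⊥)); e + u is in its shadow.
A₅ : Vec (Word 41) 41
A₅ = map (word 41)
  ( 0x02d78163831 ∷ 0x0592a110bbc ∷ 0x10ebf2dc6dd ∷ 0x12008cef711 ∷ 0x0fd67089489 ∷ 0x055f1a0c1f1
  ∷ 0x0e080741a14 ∷ 0x0d979aec11f ∷ 0x01dccec6add ∷ 0x1227d048b83 ∷ 0x0f98c9c6dad ∷ 0x05c268933b9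
  ∷ 0x033e0eaab03 ∷ 0x0fe2509083f ∷ 0x05375a3f89d ∷ 0x02d46bf3d4b ∷ 0x0c369a224af ∷ 0x029ecf5a1bd
  ∷ 0x14a3d371d43 ∷ 0x1bb45dfd265 ∷ 0x16f6f63faf3 ∷ 0x071e1761d05 ∷ 0x1e86f14f67b ∷ 0x05b73d12087
  ∷ 0x03d4a5a8d7f ∷ 0x0e3706944c7 ∷ 0x069df63616d ∷ 0x058133e0eab ∷ 0x1bb8b84d127 ∷ 0x16ef3d5fc77
  ∷ 0x072d81a100d ∷ 0x1ee1dccec6b ∷ 0x057966114a7 ∷ 0x024813ae53f ∷ 0x0d0e6a99447 ∷ 0x00ef2e2c06d
  ∷ 0x1040119dee3 ∷ 0x0b574a6c76d ∷ 0x1579fd8f471 ∷ 0x0541cbe7c1e ∷ 0x11249249248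
  ∷ [] )

certificate₅ : Certificate A₅ 5
certificate₅ = record
  { gram-A≟I       = refl
  ; gram-Aᵀ≟I      = refl
  ; noLightWord-A  = refl
  ; noLightWord-Aᵀ = refl
  ; message        = word 41 0x40
  ; message-weight = refl
  -- The only shadow vector of weight 5, since two would differ by a codeword of weight at most 10.
  -- Thus it is e + u in the present coordinates.
  ; yˡ             = word 41 0x8000000043
  ; yʳ             = word 41 0x10000000000
  ; y-weight       = refl
  ; y-balanced     = refl
  ; radius         = 0
  ; s≤5+radius*2   = m≤m+n 5 0
  ; scan-A         = refl
  ; scan-Aᵀ        = refl
  }

-- Likewise a neighbour (C ∩ u^⊥) ∪ (u + (C ∖ u^⊥)), for an 8-set u.
A₉ : Vec (Word 41) 41
A₉ = map (word 41)
  ( 0x0edb6db6db6 ∷ 0x1bbec92836e ∷ 0x13efe4789c1 ∷ 0x11049a4b80d ∷ 0x0cd2662db95 ∷ 0x065b0ca8eed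
  ∷ 0x10246f792c6 ∷ 0x0e938c48e03 ∷ 0x02d8d8625c1 ∷ 0x000754a56d6 ∷ 0x0c9cdf622b1 ∷ 0x17e2ec7eeec
  ∷ 0x111e8a47656 ∷ 0x1dc2d47d56a ∷ 0x1717ded25c8 ∷ 0x01d07d57257 ∷ 0x0f328c86bb3 ∷ 0x10be4bb7ce8
  ∷ 0x0683579c016 ∷ 0x0994d910f30 ∷ 0x04d672d27a6 ∷ 0x041a01c5219 ∷ 0x0ca675a2b2e ∷ 0x06b32bb6f9b
  ∷ 0x11f4214502a ∷ 0x1c178279992 ∷ 0x14bd72dbc38 ∷ 0x068525441b7 ∷ 0x09983ca0c72 ∷ 0x15eb2bfb36b
  ∷ 0x04299705f11 ∷ 0x0cc1582313e ∷ 0x067d70b5bbb ∷ 0x014c050aa23 ∷ 0x1f2eee74912 ∷ 0x03eb3888f71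
  ∷ 0x026095703b6 ∷ 0x08535cc8871 ∷ 0x167deb2bb6d ∷ 0x030416a4f1d ∷ 0x0a493196685
  ∷ [] )

certificate₉ : Certificate A₉ 9
certificate₉ = record
  { gram-A≟I       = refl
  ; gram-Aᵀ≟I      = refl
  ; noLightWord-A  = refl
  ; noLightWord-Aᵀ = refl
  ; message        = word 41 0x200000
  ; message-weight = refl
  ; yˡ             = word 41 0x8
  ; yʳ             = word 41 0x10200802a44
  ; y-weight       = refl
  ; y-balanced     = refl
  -- The least radius with 9 ≤ 5 + 2 * `radius`; the scans rule out coset words of weight below 6.
  ; radius         = 2
  ; s≤5+radius*2   = m≤m+n 9 0
  ; scan-A         = refl
  ; scan-Aᵀ        = refl
  }

-- A circulant matrix.
A₁₃ : Vec (Word 41) 41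
A₁₃ = map (word 41)
  ( 0x024cf125139 ∷ 0x0499e24a272 ∷ 0x0933c4944e4 ∷ 0x126789289c8 ∷ 0x04cf1251391 ∷ 0x099e24a2722
  ∷ 0x133c4944e44 ∷ 0x06789289c89 ∷ 0x0cf12513912 ∷ 0x19e24a27224 ∷ 0x13c4944e449 ∷ 0x0789289c893
  ∷ 0x0f125139126 ∷ 0x1e24a27224c ∷ 0x1c4944e4499 ∷ 0x189289c8933 ∷ 0x11251391267 ∷ 0x024a27224cf
  ∷ 0x04944e4499e ∷ 0x09289c8933c ∷ 0x12513912678 ∷ 0x04a27224cf1 ∷ 0x0944e4499e2 ∷ 0x1289c8933c4
  ∷ 0x05139126789 ∷ 0x0a27224cf12 ∷ 0x144e4499e24 ∷ 0x089c8933c49 ∷ 0x11391267892 ∷ 0x027224cf125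
  ∷ 0x04e4499e24a ∷ 0x09c8933c494 ∷ 0x13912678928 ∷ 0x07224cf1251 ∷ 0x0e4499e24a2 ∷ 0x1c8933c4944
  ∷ 0x19126789289 ∷ 0x1224cf12513 ∷ 0x04499e24a27 ∷ 0x08933c4944e ∷ 0x1126789289c
  ∷ [] )

certificate₁₃ : Certificate A₁₃ 13
certificate₁₃ = record
  { gram-A≟I       = refl
  ; gram-Aᵀ≟I      = refl
  ; noLightWord-A  = refl
  ; noLightWord-Aᵀ = refl
  -- Rows of `A₁₃` have weight 17, so a single one gives weight 18; rows 0, 3 and 21 sum to weight
  -- 11.
  ; message        = word 41 0x200009
  ; message-weight = refl
  ; yˡ             = word 41 0x7
  ; yʳ             = word 41 0x10192804850
  ; y-weight       = refl
  ; y-balanced     = refl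
  ; radius         = 4
  ; s≤5+radius*2   = m≤m+n 13 0
  ; scan-A         = refl
  ; scan-Aᵀ        = refl
  }

proposition8 : (s : ℕ) → s ∈ (1 ∷ 5 ∷ 9 ∷ 13 ∷ []) →
    ∃ λ (C : Code 82) →
    IsCode[ 82 , 41 , 14 ] C × SelfDual C × SinglyEven C × SmallestWeight (shadow C) s
proposition8 _ (here refl)                         = certified certificate₁
proposition8 _ (there (here refl))                 = certified certificate₅
proposition8 _ (there (there (here refl)))         = certified certificate₉
proposition8 _ (there (there (there (here refl)))) = certified certificate₁₃
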